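{- Let $\beta(x)=x\sum_{n=0}^{\infty}\beta_nx^n$ be a power series with complex coefficients and $\beta_0\neq0$. Let $\alpha(x)$ be the inverse function of $\beta(x)$. For $m,n\in\mathbb{N}$ we have $$[x^{m+n}]\alpha(x)^m=\frac m{(n+m)!}\sum_{k_1+2k_2+\cdots+nk_n=n}\frac{(n+m-1+k_1+\cdots+k_n)!}{k_1!\cdots k_n!}(-1)^{k_1+k_2+\cdots+k_n}\beta_0^{ -n-m-k_1-\cdots-k_n}\beta_1^{k_1}\beta_2^{k_2}\cdots\beta_n^{k_n}.$$
   Context: $\mathbb{N}$ is the set of positive integers. $[x^k]g(x)$ denotes the coefficient of $x^k$ in the power series expansion of $g(x)$. The inverse function is the compositional inverse (as power series with zero constant term): $\alpha(\beta(x))=\beta(\alpha(x))=x$. The sum runs over all $n$-tuples $(k_1,\ldots,k_n)$ of nonnegative integers with $k_1+2k_2+\cdots+nk_n=n$. -}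

module Defs where

open import Algebra.Apartness.Bundles using (HeytingCommutativeRing; HeytingField)
open import Algebra.Bundles using (CommutativeRing; Semiring)
open import Data.Fin.Base using (Fin; toℕ; zero; suc)
open import Data.List.Base as List using (List; _∷_; []; upTo; filter; cartesianProductWith)
open import Data.List.Membership.Propositional using (_∈_)
open import Data.List.Membership.Propositional.Properties
  using (∈-upTo⁺; ∈-cartesianProductWith⁺; ∈-filter⁺; ∈-filter⁻)
open import Data.List.Relation.Unary.Any using (here)
open import Data.List.Relation.Unary.All using ([])
open import Data.List.Relation.Unary.AllPairs using ([]; _∷_)
open import Data.List.Relation.Unary.Unique.Propositional using (Unique)
open import Data.List.Relation.Unary.Unique.Propositional.Properties
  using (upTo⁺; filter⁺; cartesianProductWith⁺)
open import Data.Nat.Base as ℕ using (ℕ; zero; suc; NonZero; _∸_; _≤_; _!; s≤s)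
open import Data.Nat.Properties as ℕ using (_≟_; _!≢0; m*n≢0; ≤-trans; ≤-reflexive; m≤m+n; m≤n+m; m≤n*m)
open import Data.Product.Base using (_,_; proj₁; proj₂)
open import Data.Vec.Base as Vec using (Vec; []; _∷_; lookup; tabulate)
open import Data.Vec.Properties using (∷-injective)
open import Function.Base using (_∘_)
open import Function.Bundles using (_⇔_; mk⇔)
open import Relation.Binary.PropositionalEquality.Core using (_≡_; refl)

------------------------------------------------------------------------
-- A tuple (k₁ , … , kₙ) is a Vec ℕ n; the entry kᵢ₊₁ is `lookup k i`, indices being 0-based.

-- k₁ + 2 k₂ + ⋯ + n kₙ
weight : ∀ {n} → Vec ℕ n → ℕ
weight k = Vec.sum (tabulate λ i → suc (toℕ i) ℕ.* lookup k i)

-- k₁! ⋯ kₙ!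
factorials : ∀ {n} → Vec ℕ n → ℕ
factorials []       = 1
factorials (k ∷ ks) = k ! ℕ.* factorials ks

factorials≢0 : ∀ {n} (k : Vec ℕ n) → NonZero (factorials k)
factorials≢0 []       = _
factorials≢0 (k ∷ ks) = m*n≢0 (k !) (factorials ks) {{k !≢0}} {{factorials≢0 ks}}

box : ∀ n → ℕ → List (Vec ℕ n)
box zero    b = [] ∷ []
box (suc n) b = cartesianProductWith _∷_ (upTo (suc b)) (box n b)

-- All n-tuples of weight n. Entries of such a tuple are at most n, so nothing is
-- lost by searching the box {0,…,n}ⁿ; see ∈-tuples and tuples-unique.
tuples : ∀ n → List (Vec ℕ n)
tuples n = filter (λ k → weight k ≟ n) (box n n)

private
  ∈-box : ∀ {n b} (k : Vec ℕ n) → (∀ i → lookup k i ≤ b) → k ∈ box n b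
  ∈-box []       _   = here refl
  ∈-box (k ∷ ks) k≤b = ∈-cartesianProductWith⁺ _∷_ (∈-upTo⁺ (s≤s (k≤b zero))) (∈-box ks (k≤b ∘ suc))

  box-unique : ∀ n b → Unique (box n b)
  box-unique zero    b = [] ∷ []
  box-unique (suc n) b = cartesianProductWith⁺ _∷_ ∷-injective (upTo⁺ (suc b)) (box-unique n b)

  ≤-sum : ∀ {n} (f : Fin n → ℕ) i → f i ≤ Vec.sum (tabulate f)
  ≤-sum f zero    = m≤m+n _ _
  ≤-sum f (suc i) = ≤-trans (≤-sum (f ∘ suc) i) (m≤n+m _ _)

∈-tuples : ∀ {n} (k : Vec ℕ n) → k ∈ tuples n ⇔ weight k ≡ n
∈-tuples {n} k = mk⇔
  (λ k∈ → proj₂ (∈-filter⁻ (λ k → weight k ≟ n) {xs = box n n} k∈))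
  (λ eq → ∈-filter⁺ (λ k → weight k ≟ n)
    (∈-box k λ i → ≤-trans (m≤n*m (lookup k i) (suc (toℕ i)))
                  (≤-trans (≤-sum (λ j → suc (toℕ j) ℕ.* lookup k j) i) (≤-reflexive eq)))
    eq)

tuples-unique : ∀ n → Unique (tuples n)
tuples-unique n = filter⁺ (λ k → weight k ≟ n) (box-unique n n)

------------------------------------------------------------------------
-- ℂ is generalised to a Heyting field of characteristic zero: the library has no
-- complex numbers, and only the field operations are used. Apartness from 0# is the
-- constructive reading of "≠ 0".

module FieldOps {c ℓ₁ ℓ₂} (F : HeytingField c ℓ₁ ℓ₂) where

  open HeytingField F
  open Semiring (CommutativeRing.semiring (HeytingCommutativeRing.commutativeRing heytingCommutativeRing))
    using (rawSemiring)
  open import Algebra.Apartness.Properties.HeytingCommutativeRing heytingCommutativeRing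
    using (x-0≈x)
  open import Algebra.Definitions.RawSemiring rawSemiring public
    using (_×_; _^_; sum; product)

  ι : ℕ → Carrier
  ι n = n × 1#

  CharacteristicZero : Set ℓ₂
  CharacteristicZero = ∀ n → .{{NonZero n}} → ι n # 0#

  -- #⇒invertible inverts x - 0#, not x; hence inv-inverse below.
  inv : ∀ x → x # 0# → Carrier
  inv x x#0 = proj₁ (#⇒invertible x#0)

  inv-inverse : ∀ x (x#0 : x # 0#) → x * inv x x#0 ≈ 1#
  inv-inverse x x#0 =
    trans (*-congʳ (sym (x-0≈x x))) (proj₂ (proj₂ (#⇒invertible x#0)))

  ratio : CharacteristicZero → (p q : ℕ) → .{{NonZero q}} → Carrier
  ratio char0 p q = ι p * inv (ι q) (char0 q)

  sumOver : ∀ {a} {A : Set a} → List A → (A → Carrier) → Carrier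
  sumOver xs f = List.foldr _+_ 0# (List.map f xs)

------------------------------------------------------------------------
-- A power series is its coefficient sequence.

module PowerSeries {c ℓ₁ ℓ₂} (F : HeytingField c ℓ₁ ℓ₂) where

  open HeytingField F
  open FieldOps F

  Series : Set c
  Series = ℕ → Carrier

  infix 4 _≋_
  infixl 7 _⋆_
  infixr 8 _^ˢ_
  infixr 9 _∘ˢ_

  [x^_] : ℕ → Series → Carrier
  [x^ k ] f = f k

  _≋_ : Series → Series → Set ℓ₁
  f ≋ g = ∀ k → [x^ k ] f ≈ [x^ k ] g

  one : Series
  one zero    = 1#
  one (suc _) = 0#

  x·_ : Series → Series
  (x· f) zero    = 0#
  (x· f) (suc k) = f k

  _⋆_ : Series → Series → Series
  (f ⋆ g) k = sum λ (i : Fin (suc k)) → f (toℕ i) * g (k ∸ toℕ i)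

  _^ˢ_ : Series → ℕ → Series
  f ^ˢ zero  = one
  f ^ˢ suc m = f ⋆ (f ^ˢ m)

  -- f(g(x)) = ∑ⱼ fⱼ g(x)ʲ, meaningful only when g has zero constant term: then
  -- g(x)ʲ has no terms of degree below j, so only j ≤ k contribute to xᵏ.
  _∘ˢ_ : Series → Series → Series
  (f ∘ˢ g) k = sum λ (j : Fin (suc k)) → f (toℕ j) * [x^ k ] (g ^ˢ toℕ j)

  record IsCompositionalInverse (f g : Series) : Set ℓ₁ where
    field
      f₀≈0   : f 0 ≈ 0#
      g₀≈0   : g 0 ≈ 0#
      f∘g≋x  : f ∘ˢ g ≋ x· one
      g∘f≋x  : g ∘ˢ f ≋ x· one

-- Let P(N , n) be the sum on the right, N standing for n + m. The substitution k ↦ k + eᵢ turns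
-- kᵢ / k! into 1 / k!, so weighting the summands by ∑ wᵢ kᵢ shifts the weight n; with wᵢ = i
-- and wᵢ = 1 this gives, for N ≥ 1,
--   n P(N , n) = - ∑ᵢ i βᵢ P(N + 1 , n - i)   and   ∑_{i ≥ 0} βᵢ P(N + 1 , n - i) = N P(N , n).
-- On the other hand x αᑫ = β(α) αᑫ reads [xᴹ] αᑫ = ∑ⱼ βⱼ [xᴹ⁺¹] αᑫ⁺¹⁺ʲ, which determines the
-- coefficients of the powers of α because β₀ is invertible. By the two identities above,
-- m P(N , N - m) / N! satisfies the same recurrence.
module Submission where

open import Defs
open import Algebra.Apartness.Bundles using (HeytingField; HeytingCommutativeRing)
open import Algebra.Bundles using (CommutativeRing)
open import Data.Fin.Base using (Fin; toℕ; zero; suc)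
open import Data.Fin.Properties using (toℕ<n)
open import Data.List.Base as List
  using (List; []; _∷_; _++_; upTo; applyUpTo; filter; cartesianProductWith)
open import Data.List.Properties using (filter-accept; filter-reject; map-applyUpTo; map-∘)
open import Data.Nat.Base as ℕ using (ℕ; zero; suc; NonZero; _∸_; _!; _≤_; _<_; z≤n; s≤s)
open import Data.Nat.Induction using (Acc; acc; <-wellFounded)
import Data.Nat.Properties as ℕ
open import Data.Nat.Properties using (_!≢0)
open import Data.Nat.Tactic.RingSolver using (solve-∀)
open import Data.Vec.Base as Vec using (Vec; []; _∷_; lookup; replicate; tabulate; updateAt)
open import Data.Vec.Properties using (lookup∘updateAt)
open import Function.Base using (_∘_; const)
open import Relation.Binary.PropositionalEquality as ≡ using (_≡_; _≢_)
open import Relation.Nullary.Decidable using (yes; no)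
open import Relation.Nullary.Negation using (contradiction)

-- Tuples: weights, sums and factorials under adding a unit vector.

private variable
  n : ℕ

inc : Fin n → Vec ℕ n → Vec ℕ n
inc i k = updateAt k i suc

-- `weight` is definitionally the case `w = suc ∘ toℕ`, and `const 1` gives the sum of the entries.
-- These two weightings produce the two identities for P(N , n).
weighted : (Fin n → ℕ) → Vec ℕ n → ℕ
weighted w k = Vec.sum (tabulate λ i → w i ℕ.* lookup k i)

weighted-inc : ∀ (w : Fin n → ℕ) i k → weighted w (inc i k) ≡ w i ℕ.+ weighted w k
weighted-inc w zero    (k ∷ ks) =
  ≡.trans (≡.cong (ℕ._+ weighted (w ∘ suc) ks) (ℕ.*-suc (w zero) k))
          (ℕ.+-assoc (w zero) (w zero ℕ.* k) _)
weighted-inc w (suc i) (k ∷ ks) =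
  ≡.trans (≡.cong (w zero ℕ.* k ℕ.+_) (weighted-inc (w ∘ suc) i ks))
          (exchange (w zero ℕ.* k) (w (suc i)) (weighted (w ∘ suc) ks))
  where
  exchange : ∀ x y z → x ℕ.+ (y ℕ.+ z) ≡ y ℕ.+ (x ℕ.+ z)
  exchange = solve-∀

weighted-1 : (k : Vec ℕ n) → weighted (const 1) k ≡ Vec.sum k
weighted-1 []       = ≡.refl
weighted-1 (k ∷ ks) = ≡.cong₂ ℕ._+_ (ℕ.*-identityˡ k) (weighted-1 ks)

term≤weighted : ∀ (w : Fin n → ℕ) i k → w i ℕ.* lookup k i ≤ weighted w k
term≤weighted w zero    (k ∷ ks) = ℕ.m≤m+n _ _
term≤weighted w (suc i) (k ∷ ks) = ℕ.≤-trans (term≤weighted (w ∘ suc) i ks) (ℕ.m≤n+m _ _)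

-- Every coefficient in the weight is at least 1. A tuple with an entry above D therefore has weight
-- above D, which is why shifting the box later loses nothing.
lookup≤weight : ∀ i (k : Vec ℕ n) → lookup k i ≤ weight k
lookup≤weight i k =
  ℕ.≤-trans (ℕ.m≤n*m (lookup k i) (suc (toℕ i))) (term≤weighted (suc ∘ toℕ) i k)

sum-inc : ∀ i (k : Vec ℕ n) → Vec.sum (inc i k) ≡ suc (Vec.sum k)
sum-inc zero    (k ∷ ks) = ≡.refl
sum-inc (suc i) (k ∷ ks) = ≡.trans (≡.cong (k ℕ.+_) (sum-inc i ks)) (ℕ.+-suc k _)

factorials-inc : ∀ i (k : Vec ℕ n) → factorials (inc i k) ≡ suc (lookup k i) ℕ.* factorials k
factorials-inc zero    (k ∷ ks) = ℕ.*-assoc (suc k) (k !) (factorials ks)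
factorials-inc (suc i) (k ∷ ks) =
  ≡.trans (≡.cong (k ! ℕ.*_) (factorials-inc i ks))
          (exchange (k !) (suc (lookup ks i)) (factorials ks))
  where
  exchange : ∀ x y z → x ℕ.* (y ℕ.* z) ≡ y ℕ.* (x ℕ.* z)
  exchange = solve-∀

sum-zeros : ∀ n → Vec.sum (replicate n 0) ≡ 0
sum-zeros zero    = ≡.refl
sum-zeros (suc n) = sum-zeros n

weighted-zeros : ∀ {n} (w : Fin n → ℕ) → weighted w (replicate n 0) ≡ 0
weighted-zeros {zero}  w = ≡.refl
weighted-zeros {suc n} w =
  ≡.cong₂ ℕ._+_ (ℕ.*-zeroʳ (w zero)) (weighted-zeros (w ∘ suc))

factorials-zeros : ∀ n → factorials (replicate n 0) ≡ 1
factorials-zeros zero    = ≡.refl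
factorials-zeros (suc n) = ≡.trans (ℕ.+-identityʳ _) (factorials-zeros n)

-- Finite sums in a field of characteristic zero.

module FieldSums {c ℓ₁ ℓ₂} (F : HeytingField c ℓ₁ ℓ₂) where

  open HeytingField F hiding (setoid; zero)
  open FieldOps F
  open CommutativeRing (HeytingCommutativeRing.commutativeRing heytingCommutativeRing) public
    using (commutativeSemiring; semiring; setoid; +-group)
  open import Algebra.Properties.Semiring.Sum semiring public
    using (sum-cong-≋; sum-replicate-zero; *-distribˡ-sum; *-distribʳ-sum; ∑-comm; ∑-distrib-+)
  open import Algebra.Properties.Semiring.Mult semiring using (×-homo-+; ×1-homo-*)
  open import Algebra.Solver.Ring.NaturalCoefficients.Default commutativeSemiring
  open import Relation.Binary.Reasoning.Setoid setoid

  ι-cong : ∀ {p q} → p ≡ q → ι p ≈ ι q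
  ι-cong ≡.refl = refl

  ι-+ : ∀ p q → ι (p ℕ.+ q) ≈ ι p + ι q
  ι-+ = ×-homo-+ 1#

  ι-* : ∀ p q → ι (p ℕ.* q) ≈ ι p * ι q
  ι-* = ×1-homo-*

  ι-1 : ι 1 ≈ 1#
  ι-1 = +-identityʳ 1#

  ι-sum : (f : Fin n → ℕ) → ι (Vec.sum (tabulate f)) ≈ sum (ι ∘ f)
  ι-sum {zero}  f = refl
  ι-sum {suc n} f = trans (ι-+ (f zero) _) (+-congˡ (ι-sum (f ∘ suc)))

  *-cancelˡ-invertible : ∀ {a a⁻¹ x y} → a * a⁻¹ ≈ 1# → a * x ≈ a * y → x ≈ y
  *-cancelˡ-invertible {a} {a⁻¹} {x} {y} aa⁻¹≈1 ax≈ay = begin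
    x              ≈⟨ cancel x ⟨
    a⁻¹ * (a * x)  ≈⟨ *-congˡ ax≈ay ⟩
    a⁻¹ * (a * y)  ≈⟨ cancel y ⟩
    y              ∎
    where
    cancel : ∀ z → a⁻¹ * (a * z) ≈ z
    cancel z = begin
      a⁻¹ * (a * z)  ≈⟨ solve 3 (λ u v w → v :* (u :* w) := (u :* v) :* w) refl a a⁻¹ z ⟩
      a * a⁻¹ * z    ≈⟨ *-congʳ aa⁻¹≈1 ⟩
      1# * z         ≈⟨ *-identityˡ z ⟩
      z              ∎

  sum-zero : (f : Fin n → Carrier) → (∀ i → f i ≈ 0#) → sum f ≈ 0#
  sum-zero {n} f f≈0 = trans (sum-cong-≋ f≈0) (sum-replicate-zero n)

  sum-truncate : ∀ {m n} (f : ℕ → Carrier) → n ≤ m → (∀ i → n ≤ i → f i ≈ 0#) →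
                 sum (λ (i : Fin m) → f (toℕ i)) ≈ sum (λ (i : Fin n) → f (toℕ i))
  sum-truncate {m} f z≤n       f≈0 = sum-zero {m} (f ∘ toℕ) λ i → f≈0 (toℕ i) z≤n
  sum-truncate     f (s≤s n≤m) f≈0 =
    +-congˡ (sum-truncate (f ∘ suc) n≤m λ i n≤i → f≈0 (suc i) (s≤s n≤i))

  -- Sums over lists and boxes.

  module _ {a} {A : Set a} where

    sumOver-cong : ∀ (xs : List A) {f g} → (∀ x → f x ≈ g x) → sumOver xs f ≈ sumOver xs g
    sumOver-cong []       f≈g = refl
    sumOver-cong (x ∷ xs) f≈g = +-cong (f≈g x) (sumOver-cong xs f≈g)

    sumOver-zero : ∀ (xs : List A) {f} → (∀ x → f x ≈ 0#) → sumOver xs f ≈ 0#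
    sumOver-zero []       f≈0 = refl
    sumOver-zero (x ∷ xs) f≈0 = trans (+-cong (f≈0 x) (sumOver-zero xs f≈0)) (+-identityˡ 0#)

    sumOver-++ : ∀ (xs ys : List A) f → sumOver (xs ++ ys) f ≈ sumOver xs f + sumOver ys f
    sumOver-++ []       ys f = sym (+-identityˡ _)
    sumOver-++ (x ∷ xs) ys f = trans (+-congˡ (sumOver-++ xs ys f)) (sym (+-assoc _ _ _))

    sumOver-+ : ∀ (xs : List A) f g → sumOver xs (λ x → f x + g x) ≈ sumOver xs f + sumOver xs g
    sumOver-+ []       f g = sym (+-identityˡ _)
    sumOver-+ (x ∷ xs) f g = trans (+-congˡ (sumOver-+ xs f g))
      (solve 4 (λ u v w z → (u :+ v) :+ (w :+ z) := (u :+ w) :+ (v :+ z)) refl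
             (f x) (g x) (sumOver xs f) (sumOver xs g))

    sumOver-*ˡ : ∀ (xs : List A) a f → a * sumOver xs f ≈ sumOver xs (λ x → a * f x)
    sumOver-*ˡ []       a f = zeroʳ a
    sumOver-*ˡ (x ∷ xs) a f = trans (distribˡ a _ _) (+-congˡ (sumOver-*ˡ xs a f))

    sumOver-sum : ∀ (xs : List A) (f : A → Fin n → Carrier) →
                  sumOver xs (λ x → sum (f x)) ≈ sum (λ i → sumOver xs (λ x → f x i))
    sumOver-sum {n} []       f = sym (sum-replicate-zero n)
    sumOver-sum     (x ∷ xs) f = trans (+-congˡ (sumOver-sum xs f))
      (sym (∑-distrib-+ (f x) (λ i → sumOver xs (λ y → f y i))))

  sumOver-map : ∀ {a b} {A : Set a} {B : Set b} (g : A → B) xs f →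
                sumOver (List.map g xs) f ≡ sumOver xs (f ∘ g)
  sumOver-map g xs f = ≡.cong (List.foldr _+_ 0#) (≡.sym (map-∘ xs))

  sumOver-cartesianProductWith :
    ∀ {a b d} {A : Set a} {B : Set b} {D : Set d} (g : A → B → D) xs ys f →
    sumOver (cartesianProductWith g xs ys) f ≈ sumOver xs λ x → sumOver ys (f ∘ g x)
  sumOver-cartesianProductWith g []       ys f = refl
  sumOver-cartesianProductWith g (x ∷ xs) ys f = trans
    (sumOver-++ (List.map (g x) ys) _ f)
    (+-cong (reflexive (sumOver-map (g x) ys f)) (sumOver-cartesianProductWith g xs ys f))

  sumOver-applyUpTo-suc : ∀ n (f : ℕ → Carrier) →
    sumOver (applyUpTo ℕ.suc n) f ≡ sumOver (upTo n) (f ∘ suc)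
  sumOver-applyUpTo-suc n f = ≡.cong (List.foldr _+_ 0#)
    (≡.trans (map-applyUpTo ℕ.suc f n) (≡.sym (map-applyUpTo (λ i → i) (f ∘ ℕ.suc) n)))

  -- Both sides add `f` over g(0), ..., g(n), with the last or the first term split off. A general
  -- `g` lets the induction pass to `g ∘ suc`.
  sumOver-applyUpTo-telescope : ∀ n (g : ℕ → ℕ) f →
    sumOver (applyUpTo g n) f + f (g n) ≈ f (g 0) + sumOver (applyUpTo (g ∘ suc) n) f
  sumOver-applyUpTo-telescope zero    g f = +-comm _ _
  sumOver-applyUpTo-telescope (suc n) g f = trans (+-assoc _ _ _)
    (+-congˡ (sumOver-applyUpTo-telescope n (g ∘ suc) f))

  sumOver-upTo-shift : ∀ n f → f 0 ≈ 0# → f n ≈ 0# →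
    sumOver (upTo n) f ≈ sumOver (upTo n) (f ∘ suc)
  sumOver-upTo-shift n f f0≈0 fn≈0 = begin
    sumOver (upTo n) f                 ≈⟨ +-identityʳ _ ⟨
    sumOver (upTo n) f + 0#            ≈⟨ +-congˡ fn≈0 ⟨
    sumOver (upTo n) f + f n           ≈⟨ sumOver-applyUpTo-telescope n (λ i → i) f ⟩
    f 0 + sumOver (applyUpTo ℕ.suc n) f  ≈⟨ +-congʳ f0≈0 ⟩
    0# + sumOver (applyUpTo ℕ.suc n) f   ≈⟨ +-identityˡ _ ⟩
    sumOver (applyUpTo ℕ.suc n) f      ≡⟨ sumOver-applyUpTo-suc n f ⟩
    sumOver (upTo n) (f ∘ suc)         ∎

  -- The substitution k ↦ k + eᵢ: it drops the slice kᵢ = 0 and adds the slice kᵢ = d + 1, and `h`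
  -- vanishes on both.
  sumOver-box-shift : ∀ {n} d (i : Fin n) h →
    (∀ k → lookup k i ≡ 0 → h k ≈ 0#) → (∀ k → lookup k i ≡ suc d → h k ≈ 0#) →
    sumOver (box n d) h ≈ sumOver (box n d) (h ∘ inc i)
  sumOver-box-shift {suc n} d zero    h low high = begin
    sumOver (box (suc n) d) h
      ≈⟨ sumOver-cartesianProductWith _∷_ (upTo (suc d)) (box n d) h ⟩
    sumOver (upTo (suc d)) (λ j → sumOver (box n d) (h ∘ (j ∷_)))
      ≈⟨ sumOver-upTo-shift (suc d) _
           (sumOver-zero (box n d) λ k → low (0 ∷ k) ≡.refl)
           (sumOver-zero (box n d) λ k → high (suc d ∷ k) ≡.refl) ⟩
    sumOver (upTo (suc d)) (λ j → sumOver (box n d) (h ∘ (suc j ∷_)))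
      ≈⟨ sumOver-cartesianProductWith _∷_ (upTo (suc d)) (box n d) (h ∘ inc zero) ⟨
    sumOver (box (suc n) d) (h ∘ inc zero) ∎
  sumOver-box-shift {suc n} d (suc i) h low high = begin
    sumOver (box (suc n) d) h
      ≈⟨ sumOver-cartesianProductWith _∷_ (upTo (suc d)) (box n d) h ⟩
    sumOver (upTo (suc d)) (λ j → sumOver (box n d) (h ∘ (j ∷_)))
      ≈⟨ sumOver-cong (upTo (suc d)) (λ j →
           sumOver-box-shift d i (h ∘ (j ∷_)) (low ∘ (j ∷_)) (high ∘ (j ∷_))) ⟩
    sumOver (upTo (suc d)) (λ j → sumOver (box n d) (h ∘ (j ∷_) ∘ inc i))
      ≈⟨ sumOver-cartesianProductWith _∷_ (upTo (suc d)) (box n d) (h ∘ inc (suc i)) ⟨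
    sumOver (box (suc n) d) (h ∘ inc (suc i)) ∎

  -- A tuple other than zero has a positive entry, hence has the form `inc i k`, where `h` vanishes.
  sumOver-box-only-zeros : ∀ n d h → (∀ i k → h (inc i k) ≈ 0#) →
    sumOver (box n d) h ≈ h (replicate n 0)
  sumOver-box-only-zeros zero    d h h≈0 = +-identityʳ _
  sumOver-box-only-zeros (suc n) d h h≈0 = begin
    sumOver (box (suc n) d) h
      ≈⟨ sumOver-cartesianProductWith _∷_ (upTo (suc d)) (box n d) h ⟩
    sumOver (box n d) (h ∘ (0 ∷_)) + sumOver (applyUpTo ℕ.suc d) (λ j → sumOver (box n d) (h ∘ (j ∷_)))
      ≈⟨ +-cong (sumOver-box-only-zeros n d (h ∘ (0 ∷_)) (λ i k → h≈0 (suc i) (0 ∷ k)))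
                (trans (reflexive (sumOver-applyUpTo-suc d _))
                       (sumOver-zero (upTo d) λ j → sumOver-zero (box n d) λ k → h≈0 zero (j ∷ k))) ⟩
    h (replicate (suc n) 0) + 0#
      ≈⟨ +-identityʳ _ ⟩
    h (replicate (suc n) 0) ∎

  -- Kronecker delta: the weight condition as a factor.

  δ : ℕ → ℕ → Carrier
  δ zero    zero    = 1#
  δ zero    (suc n) = 0#
  δ (suc m) zero    = 0#
  δ (suc m) (suc n) = δ m n

  δ-refl : ∀ n → δ n n ≡ 1#
  δ-refl zero    = ≡.refl
  δ-refl (suc n) = δ-refl n

  δ-≢ : ∀ {m n} → m ≢ n → δ m n ≡ 0#
  δ-≢ {zero}  {zero}  m≢n = contradiction ≡.refl m≢n
  δ-≢ {zero}  {suc n} m≢n = ≡.refl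
  δ-≢ {suc m} {zero}  m≢n = ≡.refl
  δ-≢ {suc m} {suc n} m≢n = δ-≢ (m≢n ∘ ≡.cong suc)

  δ-+-∸ : ∀ {s n} m → s ≤ n → δ (s ℕ.+ m) n ≡ δ m (n ∸ s)
  δ-+-∸ m z≤n       = ≡.refl
  δ-+-∸ m (s≤s s≤n) = δ-+-∸ m s≤n

  -- The two factors agree wherever the delta is nonzero. This allows the constant n in front of a
  -- sum to be exchanged for the weight of each summand.
  δ-*-swap : ∀ m n x → ι m * (δ m n * x) ≈ ι n * (δ m n * x)
  δ-*-swap m n x with m ℕ.≟ n
  ... | yes ≡.refl = refl
  ... | no  m≢n    = trans (vanish (ι m)) (sym (vanish (ι n)))
    where
    vanish : ∀ a → a * (δ m n * x) ≈ 0#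
    vanish a = trans (*-congˡ (trans (*-congʳ (reflexive (δ-≢ m≢n))) (zeroˡ x))) (zeroʳ a)

  -- Moves the condition from the range into the summand, so that sums for different n run over one
  -- list.
  sumOver-filter-≟ : ∀ {a} {A : Set a} (w : A → ℕ) n xs f →
    sumOver (filter (λ x → w x ℕ.≟ n) xs) f ≈ sumOver xs (λ x → δ (w x) n * f x)
  sumOver-filter-≟ w n []       f = refl
  sumOver-filter-≟ w n (x ∷ xs) f with w x ℕ.≟ n
  ... | yes ≡.refl = begin
    sumOver (filter (λ y → w y ℕ.≟ w x) (x ∷ xs)) f
      ≡⟨ ≡.cong (λ ys → sumOver ys f) (filter-accept (λ y → w y ℕ.≟ w x) ≡.refl) ⟩
    f x + sumOver (filter (λ y → w y ℕ.≟ w x) xs) f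
      ≈⟨ +-cong (sym (trans (*-congʳ (reflexive (δ-refl (w x)))) (*-identityˡ _)))
                (sumOver-filter-≟ w (w x) xs f) ⟩
    sumOver (x ∷ xs) (λ y → δ (w y) (w x) * f y) ∎
  ... | no w≢n = begin
    sumOver (filter (λ y → w y ℕ.≟ n) (x ∷ xs)) f
      ≡⟨ ≡.cong (λ ys → sumOver ys f) (filter-reject (λ y → w y ℕ.≟ n) w≢n) ⟩
    sumOver (filter (λ y → w y ℕ.≟ n) xs) f
      ≈⟨ sumOver-filter-≟ w n xs f ⟩
    sumOver xs (λ y → δ (w y) n * f y)
      ≈⟨ +-identityˡ _ ⟨
    0# + sumOver xs (λ y → δ (w y) n * f y)
      ≈⟨ +-congʳ (trans (*-congʳ (reflexive (δ-≢ w≢n))) (zeroˡ _)) ⟨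
    sumOver (x ∷ xs) (λ y → δ (w y) n * f y) ∎

-- The sums P(N , n) and their two identities.

module TuplePolynomials {c ℓ₁ ℓ₂} (F : HeytingField c ℓ₁ ℓ₂) (char0 : FieldOps.CharacteristicZero F)
  (b : PowerSeries.Series F) (b₀#0 : HeytingField._#_ F (b 0) (HeytingField.0# F)) where

  open HeytingField F hiding (setoid; zero)
  open FieldOps F
  open FieldSums F
  open import Algebra.Solver.Ring.NaturalCoefficients.Default commutativeSemiring
  open import Relation.Binary.Reasoning.Setoid setoid

  b₀⁻¹ : Carrier
  b₀⁻¹ = inv (b 0) b₀#0

  b₀-inverse : b 0 * b₀⁻¹ ≈ 1#
  b₀-inverse = inv-inverse (b 0) b₀#0

  factorials⁻¹ : Vec ℕ n → Carrier
  factorials⁻¹ k = inv (ι (factorials k)) (char0 (factorials k) {{factorials≢0 k}})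

  -- This is the passage from kᵢ / k! to 1 / k!. It is checked after multiplication by k!, where the
  -- defining equations of the inverses apply.
  factorials⁻¹-inc : ∀ i (k : Vec ℕ n) → ι (suc (lookup k i)) * factorials⁻¹ (inc i k) ≈ factorials⁻¹ k
  factorials⁻¹-inc i k = *-cancelˡ-invertible k!*k!⁻¹≈1 (begin
    ι (factorials k) * (ι (suc (lookup k i)) * factorials⁻¹ (inc i k))
      ≈⟨ solve 3 (λ x y z → x :* (y :* z) := (y :* x) :* z) refl _ _ _ ⟩
    ι (suc (lookup k i)) * ι (factorials k) * factorials⁻¹ (inc i k)
      ≈⟨ *-congʳ (ι-* (suc (lookup k i)) (factorials k)) ⟨
    ι (suc (lookup k i) ℕ.* factorials k) * factorials⁻¹ (inc i k)
      ≈⟨ *-congʳ (ι-cong (factorials-inc i k)) ⟨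
    ι (factorials (inc i k)) * factorials⁻¹ (inc i k)
      ≈⟨ inv-inverse (ι (factorials (inc i k))) _ ⟩
    1#
      ≈⟨ k!*k!⁻¹≈1 ⟨
    ι (factorials k) * factorials⁻¹ k ∎)
    where
    k!*k!⁻¹≈1 = inv-inverse (ι (factorials k)) (char0 (factorials k) {{factorials≢0 k}})

  factorials⁻¹-zeros : ∀ n → factorials⁻¹ (replicate n 0) ≈ 1#
  factorials⁻¹-zeros n = begin
    factorials⁻¹ (replicate n 0)
      ≈⟨ *-identityˡ _ ⟨
    1# * factorials⁻¹ (replicate n 0)
      ≈⟨ *-congʳ (trans (ι-cong (factorials-zeros n)) ι-1) ⟨
    ι (factorials (replicate n 0)) * factorials⁻¹ (replicate n 0)
      ≈⟨ inv-inverse (ι (factorials (replicate n 0))) _ ⟩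
    1# ∎

  monomial : (Fin n → Carrier) → Vec ℕ n → Carrier
  monomial x k = product λ i → x i ^ lookup k i

  monomial-inc : ∀ (x : Fin n → Carrier) i k → monomial x (inc i k) ≈ x i * monomial x k
  monomial-inc x zero    (k ∷ ks) = *-assoc _ _ _
  monomial-inc x (suc i) (k ∷ ks) = trans (*-congˡ (monomial-inc (x ∘ suc) i ks))
    (solve 3 (λ u v w → u :* (v :* w) := v :* (u :* w)) refl _ _ _)

  monomial-zeros : ∀ {n} (x : Fin n → Carrier) → monomial x (replicate n 0) ≈ 1#
  monomial-zeros {zero}  x = refl
  monomial-zeros {suc n} x = trans (*-identityˡ _) (monomial-zeros (x ∘ suc))

  b₊ : Fin n → Carrier
  b₊ i = b (suc (toℕ i))

  -- The summand of the theorem with `N` for n + m. For fixed `N` it depends on the tuple alone; n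
  -- enters only through the weight condition.
  term : ℕ → Vec ℕ n → Carrier
  term N k =
    ratio char0 ((N ∸ 1 ℕ.+ Vec.sum k) !) (factorials k) {{factorials≢0 k}}
    * (- 1#) ^ Vec.sum k
    * b₀⁻¹ ^ (N ℕ.+ Vec.sum k)
    * monomial b₊ k

  -- Adding eᵢ raises the sum of entries by one, so the factorial and the power of `b₀⁻¹` become
  -- those belonging to N + 1. One sign and one coefficient of `b` split off, and the factor in
  -- front cancels by `factorials⁻¹-inc`.
  term-inc : ∀ M i (k : Vec ℕ n) →
    ι (suc (lookup k i)) * term (suc M) (inc i k) ≈ - 1# * (b₊ i * term (2 ℕ.+ M) k)
  term-inc M i k rewrite sum-inc i k | ℕ.+-suc M (Vec.sum k) = begin
    l * (f * J′ * (- 1# * s) * e * monomial b₊ (inc i k))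
      ≈⟨ *-congˡ (*-congˡ (monomial-inc b₊ i k)) ⟩
    l * (f * J′ * (- 1# * s) * e * (bᵢ * π))
      ≈⟨ solve 8 (λ l f J′ s e bᵢ π u →
           l :* (f :* J′ :* (u :* s) :* e :* (bᵢ :* π)) :=
           u :* (bᵢ :* (f :* (l :* J′) :* s :* e :* π))) refl l f J′ s e bᵢ π (- 1#) ⟩
    - 1# * (bᵢ * (f * (l * J′) * s * e * π))
      ≈⟨ *-congˡ (*-congˡ (*-congʳ (*-congʳ (*-congʳ (*-congˡ (factorials⁻¹-inc i k)))))) ⟩
    - 1# * (bᵢ * (f * factorials⁻¹ k * s * e * π)) ∎
    where
    l  = ι (suc (lookup k i))
    f  = ι (suc (M ℕ.+ Vec.sum k) !)
    J′ = factorials⁻¹ (inc i k)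
    s  = (- 1#) ^ Vec.sum k
    e  = b₀⁻¹ ^ (2 ℕ.+ (M ℕ.+ Vec.sum k))
    bᵢ = b₊ i
    π  = monomial b₊ k

  -- `b 0` cancels one power of `b₀⁻¹`, and the factorial releases its top factor.
  b₀*term : ∀ M (k : Vec ℕ n) →
    b 0 * term (2 ℕ.+ M) k ≈ ι (suc M ℕ.+ Vec.sum k) * term (suc M) k
  b₀*term M k = begin
    b 0 * (ι (1+M+s ℕ.* (M ℕ.+ Vec.sum k) !) * J * s * (b₀⁻¹ * e) * π)
      ≈⟨ *-congˡ (*-congʳ (*-congʳ (*-congʳ (*-congʳ (ι-* 1+M+s ((M ℕ.+ Vec.sum k) !)))))) ⟩
    b 0 * (ι 1+M+s * f * J * s * (b₀⁻¹ * e) * π)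
      ≈⟨ solve 8 (λ b₀ b₀⁻¹ a f J s e π →
           b₀ :* (a :* f :* J :* s :* (b₀⁻¹ :* e) :* π) :=
           (b₀ :* b₀⁻¹) :* (a :* (f :* J :* s :* e :* π))) refl (b 0) b₀⁻¹ (ι 1+M+s) f J s e π ⟩
    b 0 * b₀⁻¹ * (ι 1+M+s * (f * J * s * e * π))
      ≈⟨ trans (*-congʳ b₀-inverse) (*-identityˡ _) ⟩
    ι 1+M+s * (f * J * s * e * π) ∎
    where
    1+M+s = suc M ℕ.+ Vec.sum k
    f  = ι ((M ℕ.+ Vec.sum k) !)
    J  = factorials⁻¹ k
    s  = (- 1#) ^ Vec.sum k
    e  = b₀⁻¹ ^ (suc M ℕ.+ Vec.sum k)
    π  = monomial b₊ k

  term-1-zeros : ∀ n → term 1 (replicate n 0) ≈ b₀⁻¹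
  term-1-zeros n rewrite sum-zeros n = begin
    ι 1 * factorials⁻¹ (replicate n 0) * 1# * (b₀⁻¹ * 1#) * monomial b₊ (replicate n 0)
      ≈⟨ *-cong (*-congʳ (*-congʳ (*-cong ι-1 (factorials⁻¹-zeros n)))) (monomial-zeros {n} b₊) ⟩
    1# * 1# * 1# * (b₀⁻¹ * 1#) * 1#
      ≈⟨ solve 1 (λ x → con 1 :* con 1 :* con 1 :* (x :* con 1) :* con 1 := x) refl b₀⁻¹ ⟩
    b₀⁻¹ ∎

  -- The box is fixed at D in place of n, so that one box serves every n ≤ D in the recurrences.
  module _ (D : ℕ) where

    -- Tuples have D entries here. For n ≤ D, those of weight n are zero beyond position n, so this
    -- is the P(N , n) of the overview.
    P : ℕ → ℕ → Carrier
    P N n = sumOver (box D D) λ k → δ (weight k) n * term N k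

    -- A tuple of the form `inc i k` has positive weight, so only the zero tuple contributes.
    P-1-0 : P 1 0 ≈ b₀⁻¹
    P-1-0 = begin
      P 1 0
        ≈⟨ sumOver-box-only-zeros D D _ (λ i k →
             trans (*-congʳ (reflexive (≡.cong (λ w → δ w 0) (weighted-inc (suc ∘ toℕ) i k))))
                   (zeroˡ (term 1 (inc i k)))) ⟩
      δ (weight (replicate D 0)) 0 * term 1 (replicate D 0)
        ≈⟨ *-cong (reflexive (≡.cong (λ w → δ w 0) (weighted-zeros {D} (suc ∘ toℕ)))) (term-1-zeros D) ⟩
      1# * b₀⁻¹
        ≈⟨ *-identityˡ _ ⟩
      b₀⁻¹ ∎

    module _ (M : ℕ) {n : ℕ} (n≤D : n ≤ D) where

      private
        x : Vec ℕ D → Carrier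
        x k = δ (weight k) n * term (suc M) k

        -- This is P(N + 1 , n - (i + 1)) with the subtraction moved across the delta. It vanishes
        -- for i ≥ n, where the truncated subtraction would give P(N + 1 , 0).
        shifted : ℕ → Carrier
        shifted i = sumOver (box D D) λ k → δ (suc i ℕ.+ weight k) n * term (2 ℕ.+ M) k

        shifted-≥ : ∀ i → n ≤ i → shifted i ≈ 0#
        shifted-≥ i n≤i = sumOver-zero (box D D) λ k →
          trans (*-congʳ (reflexive (δ-≢ (ℕ.>⇒≢ (s≤s (ℕ.≤-trans n≤i (ℕ.m≤m+n i (weight k))))))))
                (zeroˡ _)

        shifted-< : ∀ i → i < n → shifted i ≈ P (2 ℕ.+ M) (n ∸ suc i)
        shifted-< i i<n = sumOver-cong (box D D) λ k →
          *-congʳ (reflexive (δ-+-∸ (weight k) i<n))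

        -- The factor kᵢ kills the slice kᵢ = 0, and the weight n ≤ D excludes kᵢ = D + 1. The box
        -- may thus be shifted by eᵢ, after which `term-inc` absorbs the factor.
        sum-lookup : ∀ i →
          sumOver (box D D) (λ k → ι (lookup k i) * x k) ≈ - 1# * (b₊ i * shifted (toℕ i))
        sum-lookup i = begin
          sumOver (box D D) (λ k → ι (lookup k i) * x k)
            ≈⟨ sumOver-box-shift D i _ low high ⟩
          sumOver (box D D) (λ k → ι (lookup (inc i k) i) * x (inc i k))
            ≈⟨ sumOver-cong (box D D) step ⟩
          sumOver (box D D) (λ k → - 1# * b₊ i * (δ (suc (toℕ i) ℕ.+ weight k) n * term (2 ℕ.+ M) k))
            ≈⟨ sumOver-*ˡ (box D D) _ _ ⟨
          - 1# * b₊ i * shifted (toℕ i)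
            ≈⟨ *-assoc _ _ _ ⟩
          - 1# * (b₊ i * shifted (toℕ i)) ∎
          where
          low : ∀ k → lookup k i ≡ 0 → ι (lookup k i) * x k ≈ 0#
          low k kᵢ≡0 = trans (*-congʳ (ι-cong kᵢ≡0)) (zeroˡ _)

          high : ∀ k → lookup k i ≡ suc D → ι (lookup k i) * x k ≈ 0#
          high k kᵢ≡1+D = trans (*-congˡ (trans (*-congʳ (reflexive (δ-≢ (ℕ.>⇒≢ n<weight)))) (zeroˡ _))) (zeroʳ _)
            where
            n<weight : n < weight k
            n<weight = ℕ.≤-trans (s≤s n≤D) (ℕ.≤-trans (ℕ.≤-reflexive (≡.sym kᵢ≡1+D)) (lookup≤weight i k))

          step : ∀ k → ι (lookup (inc i k) i) * x (inc i k) ≈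
                       - 1# * b₊ i * (δ (suc (toℕ i) ℕ.+ weight k) n * term (2 ℕ.+ M) k)
          step k = begin
            ι (lookup (inc i k) i) * (δ (weight (inc i k)) n * term (suc M) (inc i k))
              ≈⟨ *-cong (ι-cong (lookup∘updateAt i k))
                        (*-congʳ (reflexive (≡.cong (λ w → δ w n) (weighted-inc (suc ∘ toℕ) i k)))) ⟩
            ι (suc (lookup k i)) * (d * term (suc M) (inc i k))
              ≈⟨ solve 3 (λ u v w → u :* (v :* w) := v :* (u :* w)) refl _ _ _ ⟩
            d * (ι (suc (lookup k i)) * term (suc M) (inc i k))
              ≈⟨ *-congˡ (term-inc M i k) ⟩
            d * (- 1# * (b₊ i * term (2 ℕ.+ M) k))
              ≈⟨ solve 4 (λ u v w z → u :* (v :* (w :* z)) := v :* w :* (u :* z)) refl d (- 1#) (b₊ i) _ ⟩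
            - 1# * b₊ i * (d * term (2 ℕ.+ M) k) ∎
            where
            d = δ (suc (toℕ i) ℕ.+ weight k) n

      -- The combination of the equations `sum-lookup` with coefficients `w i`, brought to one side
      -- so that no sign remains.
      sum-weighted : ∀ (w : ℕ → ℕ) →
        sumOver (box D D) (λ k → ι (weighted (w ∘ toℕ) k) * (δ (weight k) n * term (suc M) k))
        + sum (λ (i : Fin n) → ι (w (toℕ i)) * (b₊ i * P (2 ℕ.+ M) (n ∸ suc (toℕ i)))) ≈ 0#
      sum-weighted w = begin
        sumOver (box D D) (λ k → ι (weighted (w ∘ toℕ) k) * x k) + R
          ≈⟨ +-congʳ (begin
            sumOver (box D D) (λ k → ι (weighted (w ∘ toℕ) k) * x k)
              ≈⟨ sumOver-cong (box D D) expand ⟩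
            sumOver (box D D) (λ k → sum λ i → ι (w (toℕ i)) * (ι (lookup k i) * x k))
              ≈⟨ sumOver-sum (box D D) (λ k i → ι (w (toℕ i)) * (ι (lookup k i) * x k)) ⟩
            sum (λ i → sumOver (box D D) λ k → ι (w (toℕ i)) * (ι (lookup k i) * x k))
              ≈⟨ sum-cong-≋ (λ i → trans (sym (sumOver-*ˡ (box D D) (ι (w (toℕ i))) (λ k → ι (lookup k i) * x k)))
                                  (trans (*-congˡ (sum-lookup i)) (exchange _ _ _))) ⟩
            sum {D} (λ i → - 1# * g (toℕ i))
              ≈⟨ *-distribˡ-sum {D} (- 1#) (g ∘ toℕ) ⟨
            - 1# * sum {D} (g ∘ toℕ)
              -- Positions i ≥ n contribute nothing, so the sum of D terms shrinks to n terms.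
              ≈⟨ *-congˡ (sum-truncate g n≤D λ i n≤i →
                   trans (*-congˡ (trans (*-congˡ (shifted-≥ i n≤i)) (zeroʳ _))) (zeroʳ _)) ⟩
            - 1# * sum {n} (g ∘ toℕ)
              ≈⟨ *-congˡ (sum-cong-≋ {n} λ i → *-congˡ (*-congˡ (shifted-< (toℕ i) (toℕ<n i)))) ⟩
            - 1# * R ∎) ⟩
        - 1# * R + R
          ≈⟨ +-congˡ (*-identityˡ R) ⟨
        - 1# * R + 1# * R
          ≈⟨ distribʳ R (- 1#) 1# ⟨
        (- 1# + 1#) * R
          ≈⟨ trans (*-congʳ (-‿inverseˡ 1#)) (zeroˡ R) ⟩
        0# ∎
        where
        R = sum λ (i : Fin n) → ι (w (toℕ i)) * (b₊ i * P (2 ℕ.+ M) (n ∸ suc (toℕ i)))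

        g : ℕ → Carrier
        g i = ι (w i) * (b (suc i) * shifted i)

        exchange : ∀ u v y → u * (v * y) ≈ v * (u * y)
        exchange = solve 3 (λ u v y → u :* (v :* y) := v :* (u :* y)) refl

        expand : ∀ k → ι (weighted (w ∘ toℕ) k) * x k ≈ sum λ i → ι (w (toℕ i)) * (ι (lookup k i) * x k)
        expand k = begin
          ι (weighted (w ∘ toℕ) k) * x k
            ≈⟨ *-congʳ (ι-sum λ i → w (toℕ i) ℕ.* lookup k i) ⟩
          sum (λ i → ι (w (toℕ i) ℕ.* lookup k i)) * x k
            ≈⟨ *-distribʳ-sum (x k) (λ i → ι (w (toℕ i) ℕ.* lookup k i)) ⟩
          sum (λ i → ι (w (toℕ i) ℕ.* lookup k i) * x k)
            ≈⟨ sum-cong-≋ (λ i → trans (*-congʳ (ι-* (w (toℕ i)) (lookup k i))) (*-assoc _ _ _)) ⟩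
          sum (λ i → ι (w (toℕ i)) * (ι (lookup k i) * x k)) ∎

      -- First identity: under the delta the factor n is the weight of the tuple, so `sum-weighted`
      -- applies with `w = suc`.
      ι-*-P : ι n * P (suc M) n
              + sum (λ (i : Fin n) → ι (suc (toℕ i)) * (b₊ i * P (2 ℕ.+ M) (n ∸ suc (toℕ i)))) ≈ 0#
      ι-*-P = trans (+-congʳ (trans (sumOver-*ˡ (box D D) (ι n) x)
                                    (sumOver-cong (box D D) λ k → sym (δ-*-swap (weight k) n _))))
                    (sum-weighted suc)

      -- Second identity, with N = `suc M`: `b₀*term` yields the factor N plus the sum of the
      -- entries. The second part is the weighting by `const 1`, which cancels against the terms
      -- with i ≥ 1.
      b-convolve-P : b 0 * P (2 ℕ.+ M) n + sum (λ (i : Fin n) → b₊ i * P (2 ℕ.+ M) (n ∸ suc (toℕ i)))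
                     ≈ ι (suc M) * P (suc M) n
      b-convolve-P = begin
        b 0 * P (2 ℕ.+ M) n + T
          ≈⟨ +-congʳ (begin
            b 0 * P (2 ℕ.+ M) n
              ≈⟨ sumOver-*ˡ (box D D) (b 0) _ ⟩
            sumOver (box D D) (λ k → b 0 * (δ (weight k) n * term (2 ℕ.+ M) k))
              ≈⟨ sumOver-cong (box D D) step ⟩
            sumOver (box D D) (λ k → ι (suc M) * x k + ι (weighted (const 1) k) * x k)
              ≈⟨ sumOver-+ (box D D) _ _ ⟩
            sumOver (box D D) (λ k → ι (suc M) * x k) + V
              ≈⟨ +-congʳ (sumOver-*ˡ (box D D) (ι (suc M)) x) ⟨
            ι (suc M) * P (suc M) n + V ∎) ⟩
        ι (suc M) * P (suc M) n + V + T
          ≈⟨ +-assoc _ _ _ ⟩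
        ι (suc M) * P (suc M) n + (V + T)
          ≈⟨ +-congˡ (+-congˡ (sum-cong-≋ {n} λ i → trans (*-congʳ ι-1) (*-identityˡ _))) ⟨
        ι (suc M) * P (suc M) n
        + (V + sum (λ (i : Fin n) → ι 1 * (b₊ i * P (2 ℕ.+ M) (n ∸ suc (toℕ i)))))
          ≈⟨ +-congˡ (sum-weighted (const 1)) ⟩
        ι (suc M) * P (suc M) n + 0#
          ≈⟨ +-identityʳ _ ⟩
        ι (suc M) * P (suc M) n ∎
        where
        T = sum λ (i : Fin n) → b₊ i * P (2 ℕ.+ M) (n ∸ suc (toℕ i))
        V = sumOver (box D D) λ k → ι (weighted (const 1) k) * x k

        step : ∀ k → b 0 * (δ (weight k) n * term (2 ℕ.+ M) k) ≈
                     ι (suc M) * x k + ι (weighted (const 1) k) * x k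
        step k = begin
          b 0 * (δ (weight k) n * term (2 ℕ.+ M) k)
            ≈⟨ solve 3 (λ u v w → u :* (v :* w) := v :* (u :* w)) refl _ _ _ ⟩
          δ (weight k) n * (b 0 * term (2 ℕ.+ M) k)
            ≈⟨ *-congˡ (b₀*term M k) ⟩
          δ (weight k) n * (ι (suc M ℕ.+ Vec.sum k) * term (suc M) k)
            ≈⟨ *-congˡ (*-congʳ (trans (ι-cong (≡.cong (suc M ℕ.+_) (≡.sym (weighted-1 k))))
                                       (ι-+ (suc M) _))) ⟩
          δ (weight k) n * ((ι (suc M) + ι (weighted (const 1) k)) * term (suc M) k)
            ≈⟨ solve 4 (λ u v w z → u :* ((v :+ w) :* z) := v :* (u :* z) :+ w :* (u :* z)) refl
                     _ (ι (suc M)) (ι (weighted (const 1) k)) _ ⟩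
          ι (suc M) * x k + ι (weighted (const 1) k) * x k ∎

-- Coefficients of the powers of the inverse series.

module InversePowers {c ℓ₁ ℓ₂} (F : HeytingField c ℓ₁ ℓ₂) (char0 : FieldOps.CharacteristicZero F)
  (b : PowerSeries.Series F) (b₀#0 : HeytingField._#_ F (b 0) (HeytingField.0# F))
  (α : PowerSeries.Series F)
  (α-inverse : PowerSeries.IsCompositionalInverse F α (PowerSeries.x·_ F b)) where

  open HeytingField F hiding (setoid; zero)
  open FieldOps F
  open FieldSums F
  open PowerSeries F
  open IsCompositionalInverse α-inverse renaming (f₀≈0 to α₀≈0; g∘f≋x to β∘α≋x)
  open TuplePolynomials F char0 b b₀#0
  open import Algebra.Properties.Group +-group using () renaming (∙-cancelʳ to +-cancelʳ)
  open import Algebra.Solver.Ring.NaturalCoefficients.Default commutativeSemiring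
  open import Relation.Binary.Reasoning.Setoid setoid

  -- In the product of α with αʲ⁻¹, the first term has the factor α₀ = 0; every other term takes
  -- from αʲ⁻¹ a coefficient of degree below j - 1.
  α^-order : ∀ j k → k < j → (α ^ˢ j) k ≈ 0#
  α^-order (suc j) k (s≤s k≤j) = sum-zero (λ i → α (toℕ i) * (α ^ˢ j) (k ∸ toℕ i)) vanish
    where
    below : ∀ {k} (i : Fin k) → k ≤ j → k ∸ suc (toℕ i) < j
    below {suc k} i k<j = ℕ.≤-trans (s≤s (ℕ.m∸n≤m k (toℕ i))) k<j

    vanish : ∀ (i : Fin (suc k)) → α (toℕ i) * (α ^ˢ j) (k ∸ toℕ i) ≈ 0#
    vanish zero    = trans (*-congʳ α₀≈0) (zeroˡ _)
    vanish (suc i) = trans (*-congˡ (α^-order j (k ∸ suc (toℕ i)) (below i k≤j))) (zeroʳ _)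

  -- The coefficient of xᴷ⁺¹ in x α(x)ᵐ = β(α(x)) α(x)ᵐ.
  α^-recurrence : ∀ m K →
    (α ^ˢ m) K ≈ sum λ (j : Fin (suc K)) → b (toℕ j) * (α ^ˢ (suc m ℕ.+ toℕ j)) (suc K)
  α^-recurrence zero    K = begin
    -- This is β(α(x)) = x in degree K + 1. The composition's term of index 0 carries the zero
    -- constant coefficient of `x· b`; dropping it shifts the index by one.
    one K                 ≈⟨ β∘α≋x (suc K) ⟨
    0# * one (suc K) + R  ≈⟨ trans (+-congʳ (zeroˡ _)) (+-identityˡ R) ⟩
    R                     ∎
    where
    R = sum λ (j : Fin (suc K)) → b (toℕ j) * (α ^ˢ suc (toℕ j)) (suc K)
  α^-recurrence (suc m) K = begin
    sum (λ (i : Fin (suc K)) → α (toℕ i) * (α ^ˢ m) (K ∸ toℕ i))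
      ≈⟨ sum-cong-≋ {suc K} (λ i → *-congˡ {α (toℕ i)} (extend i)) ⟩
    sum (λ (i : Fin (suc K)) → α (toℕ i) *
      sum λ (j : Fin (suc K)) → b (toℕ j) * g (toℕ j) (toℕ i))
      ≈⟨ sum-cong-≋ {suc K} (λ i → trans
           (*-distribˡ-sum {suc K} (α (toℕ i)) (λ j → b (toℕ j) * g (toℕ j) (toℕ i)))
           (sum-cong-≋ {suc K} λ j → exchange (α (toℕ i)) (b (toℕ j)) (g (toℕ j) (toℕ i)))) ⟩
    sum (λ (i : Fin (suc K)) → sum λ (j : Fin (suc K)) → b (toℕ j) * f (toℕ j) (toℕ i))
      ≈⟨ ∑-comm {suc K} {suc K} (λ i j → b (toℕ j) * f (toℕ j) (toℕ i)) ⟩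
    sum (λ (j : Fin (suc K)) → sum λ (i : Fin (suc K)) → b (toℕ j) * f (toℕ j) (toℕ i))
      ≈⟨ sum-cong-≋ {suc K} (λ j → *-distribˡ-sum {suc K} (b (toℕ j)) (f (toℕ j) ∘ toℕ)) ⟨
    sum (λ (j : Fin (suc K)) → b (toℕ j) * sum λ (i : Fin (suc K)) → f (toℕ j) (toℕ i))
      -- The convolution in degree K + 1 has one further index i = K + 1. Its term contains the
      -- constant coefficient of a positive power of α, which is zero.
      ≈⟨ sum-cong-≋ {suc K} (λ j → *-congˡ {b (toℕ j)} (sum-truncate (f (toℕ j)) (ℕ.n≤1+n (suc K)) (f-high (toℕ j)))) ⟨
    sum (λ (j : Fin (suc K)) → b (toℕ j) * (α ^ˢ (2 ℕ.+ m ℕ.+ toℕ j)) (suc K)) ∎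
    where
    g f : ℕ → ℕ → Carrier
    g j i = (α ^ˢ (suc m ℕ.+ j)) (suc K ∸ i)
    f j i = α i * g j i

    f-high : ∀ j i → suc K ≤ i → f j i ≈ 0#
    f-high j i K<i = trans
      (*-congˡ (α^-order (suc m ℕ.+ j) _ (≡.subst (_< suc m ℕ.+ j) (≡.sym (ℕ.m≤n⇒m∸n≡0 K<i)) (s≤s z≤n))))
      (zeroʳ _)

    exchange : ∀ u v y → u * (v * y) ≈ v * (u * y)
    exchange = solve 3 (λ u v y → u :* (v :* y) := v :* (u :* y)) refl

    -- The recurrence for αᵐ in degree K - i has only K - i + 1 terms. By `α^-order` it may be
    -- padded with zeros to K + 1 terms, a range independent of i, so that the two sums can be
    -- exchanged.
    extend : ∀ (i : Fin (suc K)) → (α ^ˢ m) (K ∸ toℕ i) ≈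
             sum λ (j : Fin (suc K)) → b (toℕ j) * g (toℕ j) (toℕ i)
    extend i with suc K ∸ toℕ i | ℕ.+-∸-assoc 1 (ℕ.≤-pred (toℕ<n i))
    ... | _ | ≡.refl = trans (α^-recurrence m (K ∸ toℕ i))
      (sym (sum-truncate (λ j → b j * (α ^ˢ (suc m ℕ.+ j)) (suc (K ∸ toℕ i)))
        (s≤s (ℕ.m∸n≤m K (toℕ i)))
        λ j K-i<j → trans (*-congˡ (α^-order (suc m ℕ.+ j) _ (s≤s (ℕ.≤-trans K-i<j (ℕ.m≤n+m j m)))))
                          (zeroʳ _)))

  -- The terms with j > n vanish, since there the exponent q + 1 + j exceeds the degree q + n + 1.
  -- The term j = 0 is set apart because it holds the coefficient to be solved for.
  α^-recurrence-split : ∀ q n →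
    (α ^ˢ q) (q ℕ.+ n) ≈
      b 0 * (α ^ˢ suc q) (suc (q ℕ.+ n))
      + sum λ (i : Fin n) → b₊ i * (α ^ˢ (suc q ℕ.+ suc (toℕ i))) (suc (q ℕ.+ n))
  α^-recurrence-split q n = begin
    (α ^ˢ q) (q ℕ.+ n)
      ≈⟨ α^-recurrence q (q ℕ.+ n) ⟩
    sum (λ (j : Fin (suc (q ℕ.+ n))) → f (toℕ j))
      ≈⟨ sum-truncate f (s≤s (ℕ.m≤n+m n q)) (λ j n<j →
           trans (*-congˡ (α^-order (suc q ℕ.+ j) _ (s≤s (≡.subst (_≤ q ℕ.+ j) (ℕ.+-suc q n) (ℕ.+-monoʳ-≤ q n<j)))))
                 (zeroʳ _)) ⟩
    f 0 + sum (λ (i : Fin n) → f (suc (toℕ i)))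
      ≡⟨ ≡.cong (λ p → b 0 * (α ^ˢ suc p) (suc (q ℕ.+ n)) + sum (λ (i : Fin n) → f (suc (toℕ i))))
                (ℕ.+-identityʳ q) ⟩
    b 0 * (α ^ˢ suc q) (suc (q ℕ.+ n)) + sum (λ (i : Fin n) → f (suc (toℕ i))) ∎
    where
    f : ℕ → Carrier
    f j = b j * (α ^ˢ (suc q ℕ.+ j)) (suc (q ℕ.+ n))

  module _ (D : ℕ) where

    -- The claim cleared of the denominator N!, meant for N = p + n. A separate `N` lets the
    -- formulas for all powers in one recurrence share the same degree.
    CoefficientFormula : ℕ → ℕ → ℕ → Set ℓ₁
    CoefficientFormula n p N = ι (N !) * (α ^ˢ p) N ≈ ι p * P D N n

    -- The recurrence for αᑫ times (M + 1)!, with the formula inserted for the higher powers. Their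
    -- factor splits as (q + 1) + (i + 1), giving one sum for each identity of `P`.
    convolution : ∀ {n} q M → q ℕ.+ n ≡ M →
      (∀ (i : Fin n) → CoefficientFormula (n ∸ suc (toℕ i)) (suc q ℕ.+ suc (toℕ i)) (suc M)) →
      b 0 * (ι (suc M !) * (α ^ˢ suc q) (suc M))
      + (ι (suc q) * sum (λ (i : Fin n) → b₊ i * P D (suc M) (n ∸ suc (toℕ i)))
        + sum (λ (i : Fin n) → ι (suc (toℕ i)) * (b₊ i * P D (suc M) (n ∸ suc (toℕ i)))))
      ≈ ι (suc M) * (ι (M !) * (α ^ˢ q) M)
    convolution {n} q M ≡.refl formula = begin
      b 0 * (a * α′) + (ι (suc q) * sum T + sum U)
        ≈⟨ +-congˡ (trans (+-congʳ (*-distribˡ-sum (ι (suc q)) T))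
                          (sym (∑-distrib-+ (λ i → ι (suc q) * T i) U))) ⟩
      b 0 * (a * α′) + sum (λ i → ι (suc q) * T i + U i)
        ≈⟨ +-congˡ (sum-cong-≋ {n} step) ⟩
      b 0 * (a * α′) + sum (λ i → a * (b₊ i * α″ i))
        ≈⟨ +-cong (solve 3 (λ x y z → x :* (y :* z) := y :* (x :* z)) refl (b 0) a α′)
                  (sym (*-distribˡ-sum a (λ i → b₊ i * α″ i))) ⟩
      a * (b 0 * α′) + a * sum (λ i → b₊ i * α″ i)
        ≈⟨ distribˡ a _ _ ⟨
      a * (b 0 * α′ + sum (λ i → b₊ i * α″ i))
        ≈⟨ *-congˡ (α^-recurrence-split q n) ⟨
      a * (α ^ˢ q) M
        ≈⟨ trans (*-congʳ (ι-* (suc M) (M !))) (*-assoc _ _ _) ⟩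
      ι (suc M) * (ι (M !) * (α ^ˢ q) M) ∎
      where
      a  = ι (suc M !)
      α′ = (α ^ˢ suc q) (suc M)

      α″ T U : Fin n → Carrier
      α″ i = (α ^ˢ (suc q ℕ.+ suc (toℕ i))) (suc M)
      T  i = b₊ i * P D (suc M) (n ∸ suc (toℕ i))
      U  i = ι (suc (toℕ i)) * T i

      step : ∀ i → ι (suc q) * T i + U i ≈ a * (b₊ i * α″ i)
      step i = begin
        ι (suc q) * T i + U i
          ≈⟨ solve 4 (λ x y u v → x :* (u :* v) :+ y :* (u :* v) := u :* ((x :+ y) :* v)) refl
                   (ι (suc q)) (ι (suc (toℕ i))) (b₊ i) (P D (suc M) (n ∸ suc (toℕ i))) ⟩
        b₊ i * ((ι (suc q) + ι (suc (toℕ i))) * P D (suc M) (n ∸ suc (toℕ i)))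
          ≈⟨ *-congˡ (*-congʳ (ι-+ (suc q) (suc (toℕ i)))) ⟨
        b₊ i * (ι (suc q ℕ.+ suc (toℕ i)) * P D (suc M) (n ∸ suc (toℕ i)))
          ≈⟨ *-congˡ (formula i) ⟨
        b₊ i * (a * α″ i)
          ≈⟨ solve 3 (λ x y z → x :* (y :* z) := y :* (x :* z)) refl (b₊ i) a (α″ i) ⟩
        a * (b₊ i * α″ i) ∎

    -- Induction on n, then on p. In the recurrence the higher powers come with smaller n, and αᑫ
    -- comes with the same n and smaller exponent. `P` satisfies the same equation, so the common
    -- sums and then `b 0` cancel.
    coefficient : ∀ {n} → Acc _<_ n → n ≤ D → ∀ p M → p ℕ.+ n ≡ suc M → CoefficientFormula n p (suc M)
    -- Both sides are zero: α⁰ = 1 has no term in the positive degree M + 1, and the right side has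
    -- the factor p = 0.
    coefficient _        _   zero    M _  = trans (zeroʳ _) (sym (zeroˡ _))
    coefficient {n} (acc smaller) n≤D (suc q) M eq =
      *-cancelˡ-invertible b₀-inverse (+-cancelʳ (ι (suc q) * T M + U M) _ _
        (trans (convolution q M q+n≡M formula) (rhs M q+n≡M)))
      where
      q+n≡M : q ℕ.+ n ≡ M
      q+n≡M = ℕ.suc-injective eq

      T U : ℕ → Carrier
      T M = sum λ (i : Fin n) → b₊ i * P D (suc M) (n ∸ suc (toℕ i))
      U M = sum λ (i : Fin n) → ι (suc (toℕ i)) * (b₊ i * P D (suc M) (n ∸ suc (toℕ i)))

      formula : ∀ (i : Fin n) → CoefficientFormula (n ∸ suc (toℕ i)) (suc q ℕ.+ suc (toℕ i)) (suc M)
      formula i = coefficient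
        (smaller (ℕ.∸-monoʳ-< {n} {suc (toℕ i)} {0} (s≤s z≤n) (toℕ<n i)))
        (ℕ.≤-trans (ℕ.m∸n≤m n (suc (toℕ i))) n≤D)
        (suc q ℕ.+ suc (toℕ i)) M
        (≡.trans (ℕ.+-assoc (suc q) (suc (toℕ i)) _)
          (≡.trans (≡.cong (suc q ℕ.+_) (ℕ.m+[n∸m]≡n (toℕ<n i))) eq))

      rhs : ∀ M → q ℕ.+ n ≡ M → ι (suc M) * (ι (M !) * (α ^ˢ q) M) ≈
            b 0 * (ι (suc q) * P D (suc M) n) + (ι (suc q) * T M + U M)
      -- Here q = n = 0. The degree is 0, which `coefficient` does not cover, so α⁰ = 1 is compared
      -- directly with P(1 , 0).
      rhs zero q+n≡0 with ℕ.m+n≡0⇒m≡0 q q+n≡0 | ℕ.m+n≡0⇒n≡0 q q+n≡0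
      ... | ≡.refl | ≡.refl = begin
        ι 1 * (ι 1 * 1#)
          ≈⟨ solve 0 ((con 1 :+ con 0) :* ((con 1 :+ con 0) :* con 1) := con 1) refl ⟩
        1#
          ≈⟨ b₀-inverse ⟨
        b 0 * b₀⁻¹
          ≈⟨ *-congˡ (P-1-0 D) ⟨
        b 0 * P D 1 0
          ≈⟨ solve 2 (λ x y → x :* y :=
               x :* ((con 1 :+ con 0) :* y) :+ ((con 1 :+ con 0) :* con 0 :+ con 0)) refl (b 0) (P D 1 0) ⟩
        b 0 * (ι 1 * P D 1 0) + (ι 1 * 0# + 0#) ∎
      rhs (suc M) q+n≡1+M = begin
        ι (2 ℕ.+ M) * (ι (suc M !) * (α ^ˢ q) (suc M))
          ≈⟨ *-congˡ (coefficient (acc smaller) n≤D q M q+n≡1+M) ⟩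
        ι (2 ℕ.+ M) * (ι q * W)
          ≈⟨ +-identityʳ _ ⟨
        ι (2 ℕ.+ M) * (ι q * W) + 0#
          -- The zero is replaced by the first identity, which brings in the sum `U`.
          ≈⟨ +-congˡ (ι-*-P D M n≤D) ⟨
        ι (2 ℕ.+ M) * (ι q * W) + (ι n * W + U (suc M))
          ≈⟨ solve 5 (λ s q n w u → s :* (q :* w) :+ (n :* w :+ u) := (s :* q :+ n) :* w :+ u) refl
                   (ι (2 ℕ.+ M)) (ι q) (ι n) W (U (suc M)) ⟩
        (ι (2 ℕ.+ M) * ι q + ι n) * W + U (suc M)
          ≈⟨ +-congʳ (*-congʳ count) ⟩
        ι (suc q) * ι (suc M) * W + U (suc M)
          ≈⟨ +-congʳ (trans (*-assoc _ _ _) (*-congˡ (sym (b-convolve-P D M n≤D)))) ⟩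
        ι (suc q) * (b 0 * P D (2 ℕ.+ M) n + T (suc M)) + U (suc M)
          ≈⟨ solve 5 (λ q b p t u → q :* (b :* p :+ t) :+ u := b :* (q :* p) :+ (q :* t :+ u)) refl
                   (ι (suc q)) (b 0) (P D (2 ℕ.+ M) n) (T (suc M)) (U (suc M)) ⟩
        b 0 * (ι (suc q) * P D (2 ℕ.+ M) n) + (ι (suc q) * T (suc M) + U (suc M)) ∎
        where
        W = P D (suc M) n

        -- With q + n = M + 1 this merges the two multiples of `W` into (q + 1)(M + 1); the second
        -- identity then absorbs the factor M + 1.
        [q+n+1]q+n : ∀ q n → suc (q ℕ.+ n) ℕ.* q ℕ.+ n ≡ suc q ℕ.* (q ℕ.+ n)
        [q+n+1]q+n = solve-∀

        count : ι (2 ℕ.+ M) * ι q + ι n ≈ ι (suc q) * ι (suc M)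
        count = begin
          ι (2 ℕ.+ M) * ι q + ι n       ≈⟨ +-congʳ (ι-* (2 ℕ.+ M) q) ⟨
          ι ((2 ℕ.+ M) ℕ.* q) + ι n     ≈⟨ ι-+ ((2 ℕ.+ M) ℕ.* q) n ⟨
          ι ((2 ℕ.+ M) ℕ.* q ℕ.+ n)
            ≡⟨ ≡.cong ι (≡.subst (λ K → suc K ℕ.* q ℕ.+ n ≡ suc q ℕ.* K) q+n≡1+M ([q+n+1]q+n q n)) ⟩
          ι (suc q ℕ.* suc M)           ≈⟨ ι-* (suc q) (suc M) ⟩
          ι (suc q) * ι (suc M)         ∎

-- From the division-free formula to the quotient by (n + m)!.

theorem4p1 :
    ∀ {c ℓ₁ ℓ₂} (F : HeytingField c ℓ₁ ℓ₂) (char0 : FieldOps.CharacteristicZero F) →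
    let open HeytingField F
        open FieldOps F
        open PowerSeries F
    in
    (b : Series) (b₀#0 : b 0 # 0#) (α : Series) →
    IsCompositionalInverse α (x· b) →
    (m n : ℕ) → .{{_ : NonZero m}} → .{{_ : NonZero n}} →
    [x^ m ℕ.+ n ] (α ^ˢ m) ≈
      ratio char0 m ((n ℕ.+ m) !) {{(n ℕ.+ m) !≢0}}
      * sumOver (tuples n) (λ k →
          ratio char0 ((n ℕ.+ m ∸ 1 ℕ.+ Vec.sum k) !) (factorials k) {{factorials≢0 k}}
          * (- 1#) ^ Vec.sum k
          * inv (b 0) b₀#0 ^ (n ℕ.+ m ℕ.+ Vec.sum k)
          * product (λ (i : Fin n) → b (suc (toℕ i)) ^ lookup k i))
-- Matching on `suc n` exposes `N` as a successor, the form of degree that `coefficient` treats.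
theorem4p1 F char0 b b₀#0 α α-inverse m (suc n) = *-cancelˡ-invertible N!-inverse (begin
  ι (N !) * (α ^ˢ m) (m ℕ.+ suc n)
    ≡⟨ ≡.cong (λ K → ι (N !) * (α ^ˢ m) K) (ℕ.+-comm m (suc n)) ⟩
  ι (N !) * (α ^ˢ m) N
    -- Taking `suc n` for D makes the box of `P` the one that `tuples` filters.
    ≈⟨ coefficient (suc n) (<-wellFounded (suc n)) ℕ.≤-refl m (n ℕ.+ m) (ℕ.+-comm m (suc n)) ⟩
  ι m * P (suc n) N (suc n)
    ≈⟨ *-congˡ (sumOver-filter-≟ weight (suc n) (box (suc n) (suc n)) (term N)) ⟨
  ι m * sumOver (tuples (suc n)) (term N)
    ≈⟨ trans (*-congʳ N!-inverse) (*-identityˡ _) ⟨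
  ι (N !) * N!⁻¹ * (ι m * sumOver (tuples (suc n)) (term N))
    ≈⟨ solve 4 (λ x y u v → x :* y :* (u :* v) := x :* (u :* y :* v)) refl _ _ _ _ ⟩
  ι (N !) * (ι m * N!⁻¹ * sumOver (tuples (suc n)) (term N)) ∎)
  where
  open HeytingField F hiding (setoid; zero)
  open FieldOps F
  open FieldSums F
  open PowerSeries F
  open TuplePolynomials F char0 b b₀#0
  open InversePowers F char0 b b₀#0 α α-inverse
  open import Algebra.Solver.Ring.NaturalCoefficients.Default commutativeSemiring
  open import Relation.Binary.Reasoning.Setoid setoid

  N = suc n ℕ.+ m

  N!⁻¹ : Carrier
  N!⁻¹ = inv (ι (N !)) (char0 (N !) {{N !≢0}})

  N!-inverse : ι (N !) * N!⁻¹ ≈ 1#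
  N!-inverse = inv-inverse (ι (N !)) (char0 (N !) {{N !≢0}})
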